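{- Let $\sigma$ be a natural number. For every context $\Gamma$ (an arbitrary set of formulas over $\sigma$ propositional letters) and every formula $p$: if $p$ is a (local) semantic consequence of $\Gamma$, then $p$ is derivable from $\Gamma$ in the modal logic S5. In symbols, $$\Gamma \vDash_{\mathrm{S5}} p \;\Longrightarrow\; \Gamma \vdash_{\mathrm{S5}} p .$$
   Context: Fix a natural number $\sigma$. Formulas are generated inductively by: atoms $\#i$ for $i\in\{0,\dots,\sigma-1\}$; the false $\bot$; implications $p\supset q$; and boxed formulas $\Box p$. Abbreviations: $\sim p := p\supset\bot$ and $\Diamond p := \sim\Box\sim p$. A context is an arbitrary (possibly infinite) set of formulas. Proof system. The relation $\Gamma\vdash_{\mathrm{S5}} p$ between contexts and formulas is the inductively defined relation generated by the following rules, for all contexts $\Gamma$ and formulas $p,q,r$: (ax) if $p\in\Gamma$ then $\Gamma\vdash p$; (pl1) $\Gamma\vdash p\supset(q\supset p)$; (pl2) $\Gamma\vdash (p\supset(q\supset r))\supset((p\supset q)\supset(p\supset r))$; (pl3) $\Gamma\vdash (\sim p\supset\sim q)\supset((\sim p\supset q)\supset p)$; (k) $\Gamma\vdash \Box(p\supset q)\supset(\Box p\supset\Box q)$; (t) $\Gamma\vdash \Box p\supset p$; (s4) $\Gamma\vdash \Box p\supset\Box\Box p$; (b) $\Gamma\vdash p\supset\Box\Diamond p$; (mp) if $\Gamma\vdash p\supset q$ and $\Gamma\vdash p$ then $\Gamma\vdash q$; (nec) if $\emptyset\vdash p$ then $\Gamma\vdash\Box p$. Semantics. A model is a triple $\mathcal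 M=\langle\mathcal W,\mathcal R,\mathsf v\rangle$, where $\mathcal W$ is a non-empty set of possible worlds (worlds are taken to be sets of formulas), $\mathcal R$ is an equivalence relation on $\mathcal W$, and $\mathsf v$ assigns a Boolean truth value to each atom at each world. Truth of a formula at $w\in\mathcal W$ in $\mathcal M$ is defined recursively: $\#i$ is true at $w$ iff $\mathsf v$ assigns true to $i$ at $w$; $\bot$ is never true; $p\supset q$ is true at $w$ iff $p$ is not true at $w$ or $q$ is true at $w$; $\Box p$ is true at $w$ iff $p$ is true at every $v\in\mathcal W$ with $\mathcal R(w,v)$. A context is true at $w$ if each of its formulas is true at $w$. Local semantic consequence $\Gamma\vDash_{\mathrm{S5}}p$ means: for all models $\mathcal M$ and all worlds $w\in\mathcal W$, if $\Gamma$ is true at $w$ in $\mathcal M$ then $p$ is true at $w$ in $\mathcal M$. -}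

module Defs where

open import Data.Bool.Base using (Bool; true)
open import Data.Empty.Polymorphic using (⊥)
open import Data.Fin.Base using (Fin)
open import Data.Nat.Base using (ℕ)
open import Data.Product.Base using (∃; proj₁)
open import Data.Sum.Base using (_⊎_)
open import Function.Base using (_on_)
open import Level using (0ℓ; Lift) renaming (suc to lsuc)
open import Relation.Binary.Core using (Rel; _Preserves_⟶_)
open import Relation.Binary.Definitions using (_Respects_; _Respects₂_)
open import Relation.Binary.PropositionalEquality.Core using (_≡_)
open import Relation.Binary.Structures using (IsEquivalence)
open import Relation.Nullary.Negation.Core using (¬_)
open import Relation.Unary using (Pred; _∈_; _≐_; ∅; Satisfiable)

infix  30 #_
infix  25 ~_ □_ ◇_
infixr 20 _⊃_
infix  4 _⊢_ _⊨_

data Formula (σ : ℕ) : Set where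
  #_   : Fin σ → Formula σ
  bot  : Formula σ
  _⊃_  : Formula σ → Formula σ → Formula σ
  □_   : Formula σ → Formula σ

~_ : ∀ {σ} → Formula σ → Formula σ
~ p = p ⊃ bot

◇_ : ∀ {σ} → Formula σ → Formula σ
◇ p = ~ □ ~ p

Context : ℕ → Set₁
Context σ = Pred (Formula σ) 0ℓ

data _⊢_ {σ : ℕ} (Γ : Context σ) : Formula σ → Set where
  ax  : ∀ {p} → p ∈ Γ → Γ ⊢ p
  pl1 : ∀ {p q} → Γ ⊢ p ⊃ (q ⊃ p)
  pl2 : ∀ {p q r} → Γ ⊢ (p ⊃ (q ⊃ r)) ⊃ ((p ⊃ q) ⊃ (p ⊃ r))
  pl3 : ∀ {p q} → Γ ⊢ (~ p ⊃ ~ q) ⊃ ((~ p ⊃ q) ⊃ p)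
  k   : ∀ {p q} → Γ ⊢ □ (p ⊃ q) ⊃ (□ p ⊃ □ q)
  t   : ∀ {p} → Γ ⊢ □ p ⊃ p
  s4  : ∀ {p} → Γ ⊢ □ p ⊃ □ □ p
  b   : ∀ {p} → Γ ⊢ p ⊃ □ ◇ p
  mp  : ∀ {p q} → Γ ⊢ p ⊃ q → Γ ⊢ p → Γ ⊢ q
  nec : ∀ {p} → ∅ ⊢ p → Γ ⊢ □ p

-- Worlds are sets of formulas, and two sets with the same elements are the
-- same world.  Predicates are not extensional in Agda, so 𝒲, ℛ and 𝓋 are
-- required to respect _≐_; in particular, they do not depend on the proof
-- that a set of formulas belongs to 𝒲.
record Model (σ : ℕ) : Set₁ where
  field
    𝒲 : Pred (Context σ) 0ℓ

  World : Set₁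
  World = ∃ 𝒲

  _≈_ : Rel World 0ℓ
  _≈_ = _≐_ on proj₁

  field
    𝒲-resp   : 𝒲 Respects _≐_
    nonempty : Satisfiable 𝒲
    ℛ        : Rel World 0ℓ
    ℛ-resp   : ℛ Respects₂ _≈_
    ℛ-equiv  : IsEquivalence ℛ
    𝓋        : Fin σ → World → Bool
    𝓋-resp   : ∀ i → 𝓋 i Preserves _≈_ ⟶ _≡_

  infix 4 _⊩_ _⊩ᶜ_

  _⊩_ : World → Formula σ → Set₁
  w ⊩ # i   = Lift (lsuc 0ℓ) (𝓋 i w ≡ true)
  w ⊩ bot   = ⊥
  w ⊩ p ⊃ q = ¬ (w ⊩ p) ⊎ (w ⊩ q)
  w ⊩ □ p   = ∀ v → ℛ w v → v ⊩ p

  _⊩ᶜ_ : World → Context σ → Set₁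
  w ⊩ᶜ Γ = ∀ p → p ∈ Γ → w ⊩ p

_⊨_ : ∀ {σ} → Context σ → Formula σ → Set₁
_⊨_ {σ} Γ p = (ℳ : Model σ) → let open Model ℳ in ∀ w → w ⊩ᶜ Γ → w ⊩ p

{-# OPTIONS --safe #-}
-- Henkin's method.  If Γ ⊬ p, then Γ ∪ { ~ p } is consistent and extends to a
-- maximal consistent set, which is a world of the canonical model: worlds are
-- the maximal consistent sets, and w sees v when p ∈ v whenever □ p ∈ w.  The
-- axioms t, s4 and b make this relation an equivalence, and truth at a world is
-- membership in it, so Γ holds at the constructed world while p fails there.
module Submission where

open import Defs
open import Axiom.ExcludedMiddle using (ExcludedMiddle)
open import Data.Empty using (⊥-elim)
open import Data.List.Base using (List; []; _∷_; _++_; map; allFin; cartesianProductWith)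
open import Data.List.Membership.Propositional using () renaming (_∈_ to _∈ₗ_)
open import Data.List.Membership.Propositional.Properties
  using (∈-map⁺; ∈-allFin; ∈-++⁺ˡ; ∈-++⁺ʳ; ∈-cartesianProductWith⁺)
open import Data.List.Relation.Unary.Any using (here; there)
open import Data.Nat.Base using (ℕ; zero; suc; _⊔_; _≤_; _<_; _≤′_; ≤′-refl; ≤′-step; s≤s)
open import Data.Nat.Properties
  using (m≤m⊔n; m≤n⊔m; ≤-refl; ≤-trans; ≤⇒≤′)
open import Data.Product.Base using (∃; _×_; _,_; proj₁; proj₂)
open import Data.Sum.Base using (inj₁; inj₂; [_,_]′)
import Data.Sum.Base as Sum
open import Function.Base using (_∘_; id)
open import Function.Bundles using (mk⇔)
open import Level using (0ℓ; lift)
open import Relation.Binary.PropositionalEquality.Core using (_≡_; refl)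
open import Relation.Nullary.Decidable using (yes; no; does; dec-true; does-⇔; decidable-stable)
open import Relation.Nullary.Negation.Core using (¬_)
open import Relation.Unary using (_∈_; _∉_; _⊆_; _≐_; _∪_; ｛_｝)

private
  variable
    σ : ℕ
    Γ Δ : Context σ
    p q : Formula σ

weaken : Γ ⊆ Δ → Γ ⊢ p → Δ ⊢ p
weaken Γ⊆Δ (ax p∈Γ) = ax (Γ⊆Δ p∈Γ)
weaken Γ⊆Δ pl1      = pl1
weaken Γ⊆Δ pl2      = pl2
weaken Γ⊆Δ pl3      = pl3
weaken Γ⊆Δ k        = k
weaken Γ⊆Δ t        = t
weaken Γ⊆Δ s4       = s4
weaken Γ⊆Δ b        = b
weaken Γ⊆Δ (mp d e) = mp (weaken Γ⊆Δ d) (weaken Γ⊆Δ e)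
weaken Γ⊆Δ (nec d)  = nec d

⊃-refl : Γ ⊢ p ⊃ p
⊃-refl {p = p} = mp (mp pl2 pl1) (pl1 {q = p})

-- The `nec` case survives because its premise is derived from the empty context, so its conclusion
-- cannot depend on `p`.
deduction : Γ ∪ ｛ p ｝ ⊢ q → Γ ⊢ p ⊃ q
deduction (ax (inj₁ q∈Γ))  = mp pl1 (ax q∈Γ)
deduction (ax (inj₂ refl)) = ⊃-refl
deduction pl1      = mp pl1 pl1
deduction pl2      = mp pl1 pl2
deduction pl3      = mp pl1 pl3
deduction k        = mp pl1 k
deduction t        = mp pl1 t
deduction s4       = mp pl1 s4
deduction b        = mp pl1 b
deduction (mp d e) = mp (mp pl2 (deduction d)) (deduction e)
deduction (nec d)  = mp pl1 (nec d)

-- `pl3` with `q = bot`: then `~ p ⊃ q` is `~ ~ p`, and `~ p ⊃ ~ bot` follows from `bot ⊃ bot`.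
dne : Γ ⊢ ~ ~ p → Γ ⊢ p
dne = mp (mp pl3 (mp pl1 ⊃-refl))

dni : Γ ⊢ p ⊃ ~ ~ p
dni = deduction (deduction (mp (ax (inj₂ refl)) (ax (inj₁ (inj₂ refl)))))

~-⊃ : Γ ⊢ ~ p → Γ ⊢ p ⊃ q
~-⊃ d = deduction (dne (mp pl1 (mp (weaken inj₁ d) (ax (inj₂ refl)))))

unbox : Context σ → Context σ
unbox Γ p = □ p ∈ Γ

-- Every step of the derivation gets boxed: hypotheses are already boxed in `Γ`, axioms use `nec`,
-- and `mp` passes through `k`.
unbox-nec : unbox Γ ⊢ p → Γ ⊢ □ p
unbox-nec (ax □p∈Γ) = ax □p∈Γ
unbox-nec pl1       = nec pl1
unbox-nec pl2       = nec pl2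
unbox-nec pl3       = nec pl3
unbox-nec k         = nec k
unbox-nec t         = nec t
unbox-nec s4        = nec s4
unbox-nec b         = nec b
unbox-nec (mp d e)  = mp (mp k (unbox-nec d)) (unbox-nec e)
unbox-nec (nec d)   = nec (nec d)

Consistent : Context σ → Set
Consistent Γ = ¬ (Γ ⊢ bot)

Maximal : Context σ → Set
Maximal Γ = ∀ p → Consistent (Γ ∪ ｛ p ｝) → p ∈ Γ

MaximalConsistent : Context σ → Set
MaximalConsistent Γ = Consistent Γ × Maximal Γ

refutable-consistent : ¬ (Γ ⊢ p) → Consistent (Γ ∪ ｛ ~ p ｝)
refutable-consistent Γ⊬p = Γ⊬p ∘ dne ∘ deduction

closed : MaximalConsistent Γ → Γ ⊢ p → p ∈ Γ
closed {p = p} (con , max) d = max p (con ∘ λ e → mp (deduction e) d)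

maximalConsistent-resp : Γ ≐ Δ → MaximalConsistent Γ → MaximalConsistent Δ
maximalConsistent-resp (Γ⊆Δ , Δ⊆Γ) (con , max) =
  con ∘ weaken Δ⊆Γ , λ p con′ → Γ⊆Δ (max p (con′ ∘ weaken (Sum.map₁ Γ⊆Δ)))

-- Lindenbaum's lemma

builtFrom : List (Formula σ) → List (Formula σ)
builtFrom {σ} ps = bot ∷ map #_ (allFin σ) ++ map □_ ps ++ cartesianProductWith _⊃_ ps ps

-- Stage `n` lists the formulas of depth below `n`, with repetitions. The earlier list stays as the
-- tail, where `extend` starts, so the stages of `extend` form an increasing chain.
formulas : ℕ → List (Formula σ)
formulas zero    = []
formulas (suc n) = builtFrom (formulas n) ++ formulas n

depth : Formula σ → ℕ
depth (# i)   = 0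
depth bot     = 0
depth (p ⊃ q) = suc (depth p ⊔ depth q)
depth (□ p)   = suc (depth p)

∈-formulas : ∀ {n} (p : Formula σ) → depth p < n → p ∈ₗ formulas n
∈-formulas {σ} {suc n} (# i) _ = ∈-++⁺ˡ (there (∈-++⁺ˡ (∈-map⁺ #_ (∈-allFin i))))
∈-formulas {σ} {suc n} bot   _ = here refl
∈-formulas {σ} {suc n} (p ⊃ q) (s≤s d≤n) =
  ∈-++⁺ˡ (there (∈-++⁺ʳ (map #_ (allFin σ)) (∈-++⁺ʳ (map □_ (formulas n))
    (∈-cartesianProductWith⁺ _⊃_
      (∈-formulas p (≤-trans (s≤s (m≤m⊔n _ _)) d≤n))
      (∈-formulas q (≤-trans (s≤s (m≤n⊔m _ _)) d≤n))))))
∈-formulas {σ} {suc n} (□ p) (s≤s d≤n) =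
  ∈-++⁺ˡ (there (∈-++⁺ʳ (map #_ (allFin σ)) (∈-++⁺ˡ (∈-map⁺ □_ (∈-formulas p d≤n)))))

-- Consistency is a condition inside the membership proof: `q` joins exactly when it is consistent
-- with what came before, and no case distinction is made until `extend-consistent`.
extend : Context σ → List (Formula σ) → Context σ
extend Γ []       = Γ
extend Γ (q ∷ qs) =
  extend Γ qs ∪ λ r → q ≡ r × Consistent (extend Γ qs ∪ ｛ q ｝)

extend-++ : ∀ ps {qs} → extend Γ qs ⊆ extend Γ (ps ++ qs)
extend-++ []       = id
extend-++ (p ∷ ps) = inj₁ ∘ extend-++ ps

-- When `p` was considered, the set was a subset of the final one, hence also consistent with `p`,
-- so `p` was added then.
extend-maximal : ∀ {qs} → p ∈ₗ qs → Consistent (extend Γ qs ∪ ｛ p ｝) → p ∈ extend Γ qs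
extend-maximal (here refl)  con = inj₂ (refl , con ∘ weaken (Sum.map₁ inj₁))
extend-maximal (there p∈qs) con = inj₁ (extend-maximal p∈qs (con ∘ weaken (Sum.map₁ inj₁)))

⋃ : (ℕ → Context σ) → Context σ
⋃ C p = ∃ λ n → p ∈ C n

module _ {C : ℕ → Context σ} (C-step : ∀ n → C n ⊆ C (suc n)) where

  chain-mono′ : ∀ {m n} → m ≤′ n → C m ⊆ C n
  chain-mono′ ≤′-refl       = id
  chain-mono′ (≤′-step m≤n) = C-step _ ∘ chain-mono′ m≤n

  chain-mono : ∀ {m n} → m ≤ n → C m ⊆ C n
  chain-mono m≤n = chain-mono′ (≤⇒≤′ m≤n)

  -- A derivation is finite, so the stages of its hypotheses have a maximum.
  ⋃-compact : ⋃ C ⊢ p → ∃ λ n → C n ⊢ p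
  ⋃-compact (ax (n , p∈Cn)) = n , ax p∈Cn
  ⋃-compact pl1     = 0 , pl1
  ⋃-compact pl2     = 0 , pl2
  ⋃-compact pl3     = 0 , pl3
  ⋃-compact k       = 0 , k
  ⋃-compact t       = 0 , t
  ⋃-compact s4      = 0 , s4
  ⋃-compact b       = 0 , b
  ⋃-compact (nec d) = 0 , nec d
  ⋃-compact (mp d e) with ⋃-compact d | ⋃-compact e
  ... | m , d′ | n , e′ =
    m ⊔ n , mp (weaken (chain-mono (m≤m⊔n m n)) d′) (weaken (chain-mono (m≤n⊔m m n)) e′)

lindenbaum-limit : Context σ → Context σ
lindenbaum-limit Γ = ⋃ (extend Γ ∘ formulas)

module Canonical (em : ExcludedMiddle 0ℓ) where

  extend-consistent : Consistent Γ → ∀ qs → Consistent (extend Γ qs)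
  extend-consistent con [] = con
  extend-consistent {Γ = Γ} con (q ∷ qs) with em {Consistent (extend Γ qs ∪ ｛ q ｝)}
  ... | yes con′ = con′ ∘ weaken (Sum.map₂ proj₁)
  -- A rejected `q` leaves the set unchanged, as the added part is empty.
  ... | no ¬con′ = extend-consistent con qs ∘ weaken [ id , ⊥-elim ∘ ¬con′ ∘ proj₂ ]′

  lindenbaum : Consistent Γ → ∃ λ Δ → Γ ⊆ Δ × MaximalConsistent Δ
  lindenbaum {Γ = Γ} con = lindenbaum-limit Γ , (0 ,_) , consistent , maximal
    where
    consistent : Consistent (lindenbaum-limit Γ)
    consistent d =
      let n , d′ = ⋃-compact {C = extend Γ ∘ formulas} (λ n → extend-++ (builtFrom (formulas n))) d
      in extend-consistent con (formulas n) d′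

    maximal : Maximal (lindenbaum-limit Γ)
    maximal p con′ =
      -- The first stage whose list contains `p`.
      let n = suc (depth p) in
      n , extend-maximal (∈-formulas p ≤-refl) (con′ ∘ weaken (Sum.map₁ (n ,_)))

  ∉⇒~ : MaximalConsistent Γ → p ∉ Γ → Γ ⊢ ~ p
  ∉⇒~ {p = p} (_ , max) p∉Γ = deduction (decidable-stable em (p∉Γ ∘ max p))

  module _ {Γ₀ : Context σ} (mc₀ : MaximalConsistent Γ₀) where

    -- Symmetry: were p ∉ w, then □ ◇ ~ p ∈ w by b, so ◇ ~ p ∈ v, against □ p ∈ v.
    unbox-sym : MaximalConsistent Γ → MaximalConsistent Δ → unbox Γ ⊆ Δ → unbox Δ ⊆ Γ
    unbox-sym mcΓ mcΔ Γ□⊆Δ {p} □p∈Δ = decidable-stable em λ p∉Γ →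
      proj₁ mcΔ (mp (ax (Γ□⊆Δ (closed mcΓ (mp b (∉⇒~ mcΓ p∉Γ)))))
                    (mp (mp k (nec dni)) (ax □p∈Δ)))

    canonical : Model σ
    canonical = record
      { 𝒲        = MaximalConsistent
      ; 𝒲-resp   = maximalConsistent-resp
      ; nonempty = Γ₀ , mc₀
      ; ℛ        = λ (Γ , _) (Δ , _) → unbox Γ ⊆ Δ
      ; ℛ-resp   = (λ (Δ⊆Δ′ , _) R → Δ⊆Δ′ ∘ R) , (λ (_ , Γ′⊆Γ) R → R ∘ Γ′⊆Γ)
      ; ℛ-equiv  = record
        { refl  = λ {(_ , mc)} → closed mc ∘ mp t ∘ ax
        ; sym   = λ {(_ , mcΓ)} {(_ , mcΔ)} → unbox-sym mcΓ mcΔ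
        ; trans = λ {(_ , mc)} R S → S ∘ R ∘ closed mc ∘ mp s4 ∘ ax
        }
      ; 𝓋        = λ i (Γ , _) → does (em {# i ∈ Γ})
      ; 𝓋-resp   = λ i (Γ⊆Δ , Δ⊆Γ) → does-⇔ (mk⇔ Γ⊆Δ Δ⊆Γ) em em
      }

    open Model canonical

    mutual
      -- Both directions of the truth lemma are proved together, because the antecedent of an
      -- implication swaps them.
      ∈⇒⊩ : ∀ p (w : World) → p ∈ proj₁ w → w ⊩ p
      ∈⇒⊩ (# i) w i∈w = lift (dec-true em i∈w)
      ∈⇒⊩ bot w bot∈w = ⊥-elim (proj₁ (proj₂ w) (ax bot∈w))
      ∈⇒⊩ (p ⊃ q) w@(Γ , mc) pq∈w with em {p ∈ Γ}
      ... | yes p∈w = inj₂ (∈⇒⊩ q w (closed mc (mp (ax pq∈w) (ax p∈w))))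
      ... | no  p∉w = inj₁ (p∉w ∘ ⊩⇒∈ p w)
      ∈⇒⊩ (□ p) w □p∈w v R = ∈⇒⊩ p v (R □p∈w)

      ⊩⇒∈ : ∀ p (w : World) → w ⊩ p → p ∈ proj₁ w
      -- In the `no` case `eq` would equate `false` with `true`.
      ⊩⇒∈ (# i) w (lift eq) with yes i∈w ← em {# i ∈ proj₁ w} = i∈w
      ⊩⇒∈ (p ⊃ q) w@(Γ , mc) (inj₁ ⊮p) = closed mc (~-⊃ (∉⇒~ mc (⊮p ∘ ∈⇒⊩ p w)))
      ⊩⇒∈ (p ⊃ q) w@(Γ , mc) (inj₂ ⊩q) = closed mc (mp pl1 (ax (⊩⇒∈ q w ⊩q)))
      ⊩⇒∈ (□ p) w@(Γ , mc) ⊩□p = decidable-stable em λ □p∉w →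
        -- By `unbox-nec`, `p` is not derivable from `unbox Γ`, so `unbox Γ` with `~ p` extends to a
        -- world `v` seen from `w`; but `⊩□p` puts `p` in `v` as well.
        let Δ , ⊆Δ , mcΔ = lindenbaum (refutable-consistent (□p∉w ∘ closed mc ∘ unbox-nec))
            v = Δ , mcΔ
        in proj₁ mcΔ (mp (ax (⊆Δ (inj₂ refl))) (ax (⊩⇒∈ p v (⊩□p v (⊆Δ ∘ inj₁)))))

theorem3p0p1 : ExcludedMiddle 0ℓ → (σ : ℕ) (Γ : Context σ) (p : Formula σ) → Γ ⊨ p → Γ ⊢ p
theorem3p0p1 em σ Γ p Γ⊨p = decidable-stable em λ Γ⊬p →
  let Δ , ⊆Δ , mc = lindenbaum (refutable-consistent Γ⊬p)
      w = Δ , mc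
      p∈w = ⊩⇒∈ mc p w (Γ⊨p (canonical mc) w (λ q q∈Γ → ∈⇒⊩ mc q w (⊆Δ (inj₁ q∈Γ))))
  in proj₁ mc (mp (ax (⊆Δ (inj₂ refl))) (ax p∈w))
  where open Canonical em
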